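{- For any integer $k \geq 2$, there is an integer $N_k$ such that for every $n \geq N_k$, there exists a $k$-dicritical oriented graph with $n$ vertices and $m$ arcs, such that $m \leq (2k-3)n$. Moreover, this last inequality is strict if $k>2$.
   Context: Digraphs are finite, have no loops and no parallel arcs; two opposite arcs are allowed. An oriented graph is a digraph with no pair of opposite arcs. A subdigraph $D'$ of $D$ satisfies $V(D')\subseteq V(D)$, $A(D')\subseteq A(D)$; it is proper if $V(D')\neq V(D)$ or $A(D')\neq A(D)$. A $k$-dicolouring of a digraph is a colouring of its vertices with colours in $\{1,\dots,k\}$ such that each colour class induces an acyclic subdigraph. The dichromatic number $\vec{\chi}(D)$ is the least $k$ such that $D$ has a $k$-dicolouring. $D$ is $k$-dicritical if $\vec{\chi}(D)=k$ and $\vec{\chi}(D')<k$ for every proper subdigraph $D'$ of $D$. -}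

module Defs where

open import Data.Bool.Base using (if_then_else_)
open import Data.Empty using (⊥-elim)
open import Data.Fin.Base using (Fin)
open import Data.Fin.Subset using (Subset; _∈_; _∉_; _⊆_; _∩_; ⊥; ∣_∣)
open import Data.Fin.Subset.Properties using (_∈?_; ∉⊥; x∈p∩q⁺; x∈p∩q⁻)
open import Data.List.Base using (List; _∷_; _∷ʳ_)
open import Data.List.Relation.Unary.Linked using (Linked)
open import Data.List.Relation.Unary.Unique.Propositional using (Unique)
open import Data.Nat.Base using (ℕ; _≤_; _<_)
open import Data.Nat.Properties using (_≟_)
open import Data.Product.Base using (_×_; _,_; proj₁; proj₂; ∃-syntax)
open import Data.Sum.Base using (_⊎_)
open import Data.Vec.Base using (Vec; lookup; tabulate; map; sum)
open import Data.Vec.Properties using (lookup∘tabulate)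
open import Relation.Binary.PropositionalEquality using (_≢_; subst)
open import Relation.Nullary using (¬_; yes; no; does)
open import Relation.Nullary.Decidable using (⌊_⌋)

-- The vertex set is a subset V of an ambient set Fin a, which need not be all
-- of Fin a, so that a digraph and its subdigraphs live in the same type.
-- Row u of A is the set of out-neighbours of u; hence there are no parallel
-- arcs, and equality of arc sets is propositional equality of the field A.
record Digraph (a : ℕ) : Set where
  field
    V        : Subset a
    A        : Vec (Subset a) a
    source   : ∀ {u v} → v ∈ lookup A u → u ∈ V
    target   : ∀ {u v} → v ∈ lookup A u → v ∈ V
    loopless : ∀ {v} → v ∉ lookup A v

open Digraph public

Arc : ∀ {a} → Digraph a → Fin a → Fin a → Set
Arc D u v = v ∈ lookup (A D) u

order : ∀ {a} → Digraph a → ℕ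
order D = ∣ V D ∣

size : ∀ {a} → Digraph a → ℕ
size D = sum (map ∣_∣ (A D))

Oriented : ∀ {a} → Digraph a → Set
Oriented D = ∀ {u v} → Arc D u v → ¬ Arc D v u

Subdigraph : ∀ {a} → Digraph a → Digraph a → Set
Subdigraph D′ D = V D′ ⊆ V D × (∀ {u v} → Arc D′ u v → Arc D u v)

ProperSubdigraph : ∀ {a} → Digraph a → Digraph a → Set
ProperSubdigraph D′ D = Subdigraph D′ D × (V D′ ≢ V D ⊎ A D′ ≢ A D)

module _ {a : ℕ} (D : Digraph a) (X : Subset a) where

  inducedRow : Fin a → Subset a
  inducedRow u = if does (u ∈? X) then lookup (A D) u ∩ X else ⊥

  induced-row⁻ : ∀ {u v} → v ∈ inducedRow u → Arc D u v × u ∈ X × v ∈ X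
  induced-row⁻ {u} v∈ with u ∈? X
  ... | yes u∈X = let uv , v∈X = x∈p∩q⁻ (lookup (A D) u) X v∈ in uv , u∈X , v∈X
  ... | no  _   = ⊥-elim (∉⊥ v∈)

  induced-arc⁻ : ∀ {u v} → v ∈ lookup (tabulate inducedRow) u → Arc D u v × u ∈ X × v ∈ X
  induced-arc⁻ {u} {v} v∈ = induced-row⁻ (subst (v ∈_) (lookup∘tabulate inducedRow u) v∈)

  induced : Digraph a
  induced .V = V D ∩ X
  induced .A = tabulate inducedRow
  induced .source v∈ = let uv , u∈X , _ = induced-arc⁻ v∈ in x∈p∩q⁺ (source D uv , u∈X)
  induced .target v∈ = let uv , _ , v∈X = induced-arc⁻ v∈ in x∈p∩q⁺ (target D uv , v∈X)
  induced .loopless v∈ = loopless D (proj₁ (induced-arc⁻ v∈))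

-- The cycle v → v₁ → … → vₗ → v on the distinct vertices v ∷ vs, where
-- vs = v₁ … vₗ. Since digraphs are loopless, vs cannot be empty.
DirectedCycle : ∀ {a} → Digraph a → Fin a → List (Fin a) → Set
DirectedCycle D v vs = Unique (v ∷ vs) × Linked (Arc D) ((v ∷ vs) ∷ʳ v)

Acyclic : ∀ {a} → Digraph a → Set
Acyclic D = ∀ v vs → ¬ DirectedCycle D v vs

colourClass : ∀ {a} → (Fin a → ℕ) → ℕ → Subset a
colourClass c i = tabulate λ v → ⌊ c v ≟ i ⌋

-- Colours are 0, …, k − 1. Only the values of c on V D matter; the bound is
-- imposed there only, so the digraph without vertices is 0-dicolourable
-- whatever the ambient set.
IsDicolouring : ∀ {a} → Digraph a → ℕ → (Fin a → ℕ) → Set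
IsDicolouring D k c =
  (∀ v → v ∈ V D → c v < k) ×
  (∀ i → i < k → Acyclic (induced D (colourClass c i)))

Dicolourable : ∀ {a} → Digraph a → ℕ → Set
Dicolourable D k = ∃[ c ] IsDicolouring D k c

IsDichromaticNumber : ∀ {a} → Digraph a → ℕ → Set
IsDichromaticNumber D k = Dicolourable D k × (∀ j → Dicolourable D j → k ≤ j)

Dicritical : ∀ {a} → ℕ → Digraph a → Set
Dicritical {a} k D =
  IsDichromaticNumber D k ×
  (∀ (D′ : Digraph a) → ProperSubdigraph D′ D →
     ∃[ j ] (IsDichromaticNumber D′ j × j < k))

{-# OPTIONS --safe #-}
module Submission where

-- Throughout, a relation is called k-critical when it is not k-dicolourable but
-- becomes so once any arc is deleted. Without loops and isolated vertices, this
-- means being (k+1)-dicritical.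
--
-- Everything rests on one construction (Replace). Let D be (k-1)-critical, let
-- H be k-critical, let a be a vertex of H and let S be a nonempty set of
-- out-neighbours of a. Delete the arcs from a to S and add a disjoint copy of
-- D with all arcs from a to D and from D to S. The result is k-critical:
--
-- * In a k-dicolouring some vertex v of D has the colour of a, because D is not
--   (k-1)-dicolourable. Each deleted arc from a to s can then be rerouted
--   through v, so the restriction to H would be a dicolouring of H.
-- * After the deletion of an arc e, combine a k-dicolouring of H minus one arc,
--   which is e if e lies in H and an arc from a to S otherwise, with a
--   dicolouring of D, or of D minus e if e lies in D. Unless e lies in H, the
--   latter is chosen so that only the end of e in D, or no vertex at all if e
--   lies in D, may have the colour of a. Monochromatic walks enter D from a
--   only, and contracting their excursions into D to a turns closed walks into
--   closed walks of the coloured part of H (noClosedWalk-⊎).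
--
-- The loop is k-critical for every positive k. Replacing the loop by D joins D
-- to a new vertex x by digons; replacing then all the arcs leaving x by a
-- second copy of D removes all the digons (tripleJoin). Hence some k-critical
-- oriented graph exists, possibly with far too many arcs. For k = 1, starting
-- from the single vertex, it is the directed triangle, and replacing one arc
-- by a single vertex is subdivision, which yields all longer directed cycles.
--
-- The rest is induction on j. Suppose that, for all large m, there is a
-- (j+1)-critical oriented graph with m vertices and at most (2j+1)m arcs.
-- Replacing a single arc of a (j+2)-critical oriented graph by it adds m
-- vertices and at most (2j+1)m + 2m - 1 = (2j+3)m - 1 arcs (arcs-replace). So
-- the excess, that is, the number of arcs minus 2j+3 times the number of
-- vertices, drops by at least 1. By iteration one reaches an excess of at most
-- 0; one further replacement, with m free, realises every large order with
-- negative excess (family-step).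
--
-- Dicolourings are handled through closed walks rather than cycles; both notions
-- of acyclicity agree because a closed walk contains a cycle (walk⇒path). That
-- every proper subdigraph has a dichromatic number uses that dicolourability
-- is decidable (dicolourable?).

open import Defs
open import Data.Bool.Base using (Bool; true; false; if_then_else_)
open import Data.Empty using (⊥)
open import Data.Fin.Base using (Fin; zero; suc; punchIn; punchOut; splitAt; join; _↑ˡ_; _↑ʳ_; toℕ; fromℕ; fromℕ<; finToFun; funToFin)
import Data.Fin.Properties as Fin
open import Data.Fin.Properties using (punchIn-injective; punchInᵢ≢i; punchOut-injective; any?; all?; splitAt-join; join-splitAt)
open import Data.Fin.Subset as Subset using (Subset; _∈_; ∣_∣)
open import Data.Fin.Subset.Properties using (_∈?_; ∈⊤; ∣⊤∣≡n; ⊆-antisym; x∈p∩q⁺)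
open import Data.List.Base as List using (List; []; _∷_; _∷ʳ_; length)
open import Data.List.Membership.Propositional.Properties using (∈-lookup)
open import Data.List.Relation.Unary.All as All using ([]; _∷_)
open import Data.List.Relation.Unary.All.Properties using (¬Any⇒All¬)
open import Data.List.Relation.Unary.AllPairs using ([]; _∷_)
open import Data.List.Relation.Unary.Any using (here; there)
open import Data.List.Relation.Unary.Linked as Linked using (Linked; [-]; _∷_; linked?)
open import Data.List.Relation.Unary.Unique.DecPropositional using (unique?)
open import Data.List.Relation.Unary.Unique.Propositional using (Unique)
open import Data.Nat.Base using (ℕ; zero; suc; _≤_; _<_; _≥_; _>_; _*_; _∸_; _+_; _^_; _⊓_; z≤n; s≤s; s≤s⁻¹)
import Data.Nat.Properties as ℕ
open import Data.Nat.Tactic.RingSolver using (solve-∀)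
open import Data.Product.Base using (Σ; _×_; ∃-syntax; _,_; proj₁; proj₂)
import Data.Sum.Base as Sum
open import Data.Sum.Base using (_⊎_; inj₁; inj₂; [_,_]′)
open import Data.Unit.Base using (⊤; tt)
open import Data.Vec.Base as Vec using (Vec; lookup; tabulate)
open import Data.Vec.Properties using (lookup∘tabulate; tabulate∘lookup; tabulate-cong; tabulate-∘; lookup⇒[]=; []=⇒lookup)
open import Function.Base using (_∘_; id)
open import Level using (0ℓ)
open import Relation.Binary.Construct.Closure.Transitive using (TransClosure; [_]; _∷_; _++_)
open import Relation.Binary.Core using (Rel)
open import Relation.Binary.Definitions using (Decidable; DecidableEquality)
open import Relation.Binary.PropositionalEquality using (_≡_; _≢_; refl; sym; trans; cong; cong₂; subst; subst₂; module ≡-Reasoning)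
open import Relation.Nullary using (¬_; Dec; yes; no; does; ¬?; contradiction; _×-dec_)
open import Relation.Nullary.Decidable using (map′; _⊎-dec_; _→-dec_; isYes≗does; dec-true; decidable-stable; ⌊_⌋)
open import Algebra.Properties.CommutativeMonoid.Sum ℕ.+-0-commutativeMonoid using (sum; sum-syntax; sum-cong-≗; sum-replicate-zero; ∑-distrib-+; ∑-comm)

private
  variable
    X Y : Set
    k n : ℕ

-- Closed walks and monochromatic arcs

NoClosedWalk : Rel X 0ℓ → Set
NoClosedWalk R = ∀ x → ¬ TransClosure R x x

map-walk : {R : Rel X 0ℓ} {S : Rel Y 0ℓ} (f : X → Y) →
  (∀ {x y} → R x y → S (f x) (f y)) →
  ∀ {x y} → TransClosure R x y → TransClosure S (f x) (f y)
map-walk f step [ r ]   = [ step r ]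
map-walk f step (r ∷ w) = step r ∷ map-walk f step w

bind-walk : {R : Rel X 0ℓ} {S : Rel Y 0ℓ} (f : X → Y) →
  (∀ {x y} → R x y → TransClosure S (f x) (f y)) →
  ∀ {x y} → TransClosure R x y → TransClosure S (f x) (f y)
bind-walk f step [ r ]   = step r
bind-walk f step (r ∷ w) = step r ++ bind-walk f step w

-- The arcs whose two ends have the same colour.
Mono : {C : Set} → Rel X 0ℓ → (X → C) → Rel X 0ℓ
Mono R c x y = R x y × c x ≡ c y

-- A k-dicolouring: no colour class contains a closed walk.
Colouring : ℕ → Rel X 0ℓ → Set
Colouring {X} k R = Σ (X → Fin k) λ c → NoClosedWalk (Mono R c)

infixl 6 _∖_

-- Deletion of one arc.
_∖_ : Rel X 0ℓ → X × X → Rel X 0ℓ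
(R ∖ (u , v)) x y = R x y × ¬ (x ≡ u × y ≡ v)

-- Critical relations

-- Criticality under deletion of arcs. Loops are allowed, and no vertex is
-- isolated.
record ArcCritical (k : ℕ) (R : Rel X 0ℓ) : Set where
  field
    uncolourable : ¬ Colouring k R
    deletion     : ∀ {u v} → R u v → Colouring k (R ∖ (u , v))
    covered      : ∀ x → (∃[ y ] R x y) ⊎ (∃[ y ] R y x)

-- The field alone expresses that R has no loop and that deleting any vertex v
-- leaves a k-dicolourable relation: with one more colour available, any colour γ
-- can be reserved for v. In this form it also covers the single vertex for
-- k = 0, where no function from X to the k colours exists.
record Critical (k : ℕ) (R : Rel X 0ℓ) : Set where
  field
    uncolourable : ¬ Colouring k R
    deletion     : ∀ {u v} → R u v → Colouring k (R ∖ (u , v))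
    alone        : ∀ v (γ : Fin (suc k)) → Σ (X → Fin (suc k)) λ c →
                   NoClosedWalk (Mono R c) × (∀ x → c x ≡ γ → x ≡ v)
    point        : X

-- Insert a new colour γ and use it at v only.
module _ (_≟_ : DecidableEquality X) (v : X) (γ : Fin (suc k)) (c : X → Fin k) where

  recolour : X → Fin (suc k)
  recolour x with x ≟ v
  ... | yes _ = γ
  ... | no  _ = punchIn γ (c x)

  recolour-alone : ∀ x → recolour x ≡ γ → x ≡ v
  recolour-alone x eq with x ≟ v
  ... | yes x≡v = x≡v
  ... | no  _   = contradiction eq (punchInᵢ≢i γ (c x))

  recolour-mono : ∀ {x y} → recolour x ≡ recolour y →
    (x ≡ v × y ≡ v) ⊎ (x ≢ v × y ≢ v × c x ≡ c y)
  recolour-mono {x} {y} eq with x ≟ v | y ≟ v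
  ... | yes p | yes q = inj₁ (p , q)
  ... | yes p | no  q = contradiction (sym eq) (punchInᵢ≢i γ (c y))
  ... | no  p | yes q = contradiction eq (punchInᵢ≢i γ (c x))
  ... | no  p | no  q = inj₂ (p , q , punchIn-injective γ (c x) (c y) eq)

-- A dicolouring of R without some arc at v is also one of R without v.
arcCritical⇒critical : {R : Rel X 0ℓ} → DecidableEquality X → (∀ {x} → ¬ R x x) → X →
  ArcCritical k R → Critical k R
arcCritical⇒critical {X} {k} {R} _≟_ irrefl x₀ crit = record
  { uncolourable = uncolourable
  ; deletion     = deletion
  ; alone        = alone
  ; point        = x₀
  }
  where
  open ArcCritical crit

  extend : ∀ v (γ : Fin (suc k)) {e} → (v ≡ proj₁ e ⊎ v ≡ proj₂ e) → Colouring k (R ∖ e) →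
    Σ (X → Fin (suc k)) λ c → NoClosedWalk (Mono R c) × (∀ x → c x ≡ γ → x ≡ v)
  extend v γ {e} at (c , ok) =
    recolour _≟_ v γ c , (λ x w → ok x (map-walk id step w)) , recolour-alone _≟_ v γ c
    where
    step : ∀ {x y} → Mono R (recolour _≟_ v γ c) x y → Mono (R ∖ e) c x y
    step (r , eq) with recolour-mono _≟_ v γ c eq
    ... | inj₁ (refl , refl)   = contradiction r irrefl
    ... | inj₂ (x≢v , y≢v , q) =
      (r , λ { (refl , refl) → [ x≢v ∘ sym , y≢v ∘ sym ]′ at }) , q

  alone : ∀ v (γ : Fin (suc k)) → Σ (X → Fin (suc k)) λ c →
    NoClosedWalk (Mono R c) × (∀ x → c x ≡ γ → x ≡ v)
  alone v γ with covered v
  ... | inj₁ (_ , r) = extend v γ (inj₁ refl) (deletion r)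
  ... | inj₂ (_ , r) = extend v γ (inj₂ refl) (deletion r)

-- The replacement of arcs by a digraph

-- H with each arc from a to S replaced by all paths a → x → s with x in D.
module _ (D : Rel X 0ℓ) (H : Rel Y 0ℓ) (a : Y) (S : Y → Set) where

  Replace : Rel (X ⊎ Y) 0ℓ
  Replace (inj₁ x) (inj₁ x′) = D x x′
  Replace (inj₁ x) (inj₂ y)  = S y
  Replace (inj₂ y) (inj₁ x)  = y ≡ a
  Replace (inj₂ y) (inj₂ y′) = H y y′ × ¬ (y ≡ a × S y′)

-- The criterion behind all the dicolourings below. Let M enter X from a only, and
-- let P contain all vertices of X that M can reach from a within X. If a can be joined in H
-- to every vertex where such a walk leaves X, then closed walks of M meeting Y
-- project to closed walks of H, by contracting each excursion into X to a.
module _ (M : Rel (X ⊎ Y) 0ℓ) {D : Rel X 0ℓ} {H : Rel Y 0ℓ} (a : Y) (P : X → Set)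
  (xx : ∀ {x x′} → M (inj₁ x) (inj₁ x′) → D x x′)
  (yy : ∀ {y y′} → M (inj₂ y) (inj₂ y′) → H y y′)
  (enter : ∀ {x y} → M (inj₂ y) (inj₁ x) → y ≡ a × P x)
  (stay : ∀ {x x′} → P x → M (inj₁ x) (inj₁ x′) → P x′)
  (leave : ∀ {x y} → P x → M (inj₁ x) (inj₂ y) → H a y) where

  private
    fromX : ∀ {x y} → P x → TransClosure M (inj₁ x) (inj₂ y) → TransClosure H a y
    fromY : ∀ {y y′} → TransClosure M (inj₂ y) (inj₂ y′) → TransClosure H y y′
    fromX p [ m ]                  = [ leave p m ]
    fromX p (_∷_ {y = inj₁ x} m w) = fromX (stay p m) w
    fromX p (_∷_ {y = inj₂ y} m w) = leave p m ∷ fromY w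
    fromY [ m ] = [ yy m ]
    fromY (_∷_ {y = inj₁ x} m w) with enter m
    ... | refl , p = fromX p w
    fromY (_∷_ {y = inj₂ y} m w) = yy m ∷ fromY w

    -- A walk between vertices of X stays in X, or it can be cut at a vertex of Y.
    inside-or-through : ∀ {x x′} → TransClosure M (inj₁ x) (inj₁ x′) →
      TransClosure D x x′ ⊎
      (∃[ y ] (TransClosure M (inj₁ x) (inj₂ y) × TransClosure M (inj₂ y) (inj₁ x′)))
    inside-or-through [ m ] = inj₁ [ xx m ]
    inside-or-through (_∷_ {y = inj₁ z} m w) with inside-or-through w
    ... | inj₁ d            = inj₁ (xx m ∷ d)
    ... | inj₂ (y , w₁ , w₂) = inj₂ (y , m ∷ w₁ , w₂)
    inside-or-through (_∷_ {y = inj₂ y} m w) = inj₂ (y , [ m ] , w)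

  noClosedWalk-⊎ : NoClosedWalk D → NoClosedWalk H → NoClosedWalk M
  noClosedWalk-⊎ okD okH (inj₂ y) w = okH y (fromY w)
  noClosedWalk-⊎ okD okH (inj₁ x) w with inside-or-through w
  ... | inj₁ d             = okD x d
  ... | inj₂ (y , w₁ , w₂) = okH y (fromY (w₂ ++ w₁))

module _ {D : Rel X 0ℓ} {H : Rel Y 0ℓ} (_≟_ : DecidableEquality Y)
  (critD : Critical k D) (critH : ArcCritical (suc k) H)
  (a : Y) {S : Y → Set} (S? : ∀ y → Dec (S y)) (S⊆ : ∀ {y} → S y → H a y) (b : Y) (b∈S : S b) where

  private
    module D = Critical critD
    module H = ArcCritical critH
    N = Replace D H a S

  replace-uncolourable : ¬ Colouring (suc k) N
  replace-uncolourable (c , ok) = D.uncolourable (cD , okD)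
    where
    -- If x had the colour of a, every arc from a to S could be rerouted via x.
    unused : ∀ x → c (inj₂ a) ≢ c (inj₁ x)
    unused x eq = H.uncolourable
      (c ∘ inj₂ , λ y w → ok (inj₂ y) (bind-walk inj₂ step w))
      where
      step : ∀ {y y′} → Mono H (c ∘ inj₂) y y′ → TransClosure (Mono N c) (inj₂ y) (inj₂ y′)
      step {y} {y′} (h , q) with y ≟ a | S? y′
      ... | yes refl | yes s = (refl , eq) ∷ [ s , trans (sym eq) q ]
      ... | no  y≢a  | _     = [ (h , y≢a ∘ proj₁) , q ]
      ... | yes _    | no ¬s = [ (h , ¬s ∘ proj₂) , q ]

    cD : X → Fin k
    cD x = punchOut (unused x)

    okD : NoClosedWalk (Mono D cD)
    okD x w = ok (inj₁ x)
      (map-walk inj₁ (λ (d , q) → d , punchOut-injective (unused _) (unused _) q) w)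

  replace-deletion : ∀ {p q} → N p q → Colouring (suc k) (N ∖ (p , q))
  -- D avoids the colour of a, so no monochromatic walk enters D.
  replace-deletion {inj₁ u} {inj₁ u′} d =
    let cD , okD = D.deletion d
        cH , okH = H.deletion (S⊆ b∈S)
        c = [ punchIn (cH a) ∘ cD , cH ]′
    in c , noClosedWalk-⊎ (Mono (N ∖ (inj₁ u , inj₁ u′)) c) a (λ _ → ⊥)
      (λ ((d , ≢e) , q) → (d , λ (r , s) → ≢e (cong inj₁ r , cong inj₁ s)) ,
                          punchIn-injective (cH a) _ _ q)
      (λ (((h , ≢S) , _) , q) → (h , λ { (refl , refl) → ≢S (refl , b∈S) }) , q)
      (λ { ((refl , _) , q) → contradiction (sym q) (punchInᵢ≢i (cH a) _) })
      (λ ())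
      (λ ())
      okD okH
  -- Only v can have the colour of a, and the arc from v to y is missing, as is
  -- the arc from a to y in the coloured part of H.
  replace-deletion {inj₁ v} {inj₂ y} s =
    let cH , okH = H.deletion (S⊆ s)
        cD , okD , only = D.alone v (cH a)
        c = [ cD , cH ]′
    in c , noClosedWalk-⊎ (Mono (N ∖ (inj₁ v , inj₂ y)) c) a (λ x → cD x ≡ cH a)
      (λ ((d , _) , q) → d , q)
      (λ (((h , ≢S) , _) , q) → (h , λ { (refl , refl) → ≢S (refl , s) }) , q)
      (λ { ((refl , _) , q) → refl , sym q })
      (λ p (_ , q) → trans (sym q) p)
      (λ { p ((s′ , ≢e) , q) →
         (S⊆ s′ , λ { (_ , refl) → ≢e (cong inj₁ (only _ p) , refl) }) , trans (sym p) q })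
      okD okH
  -- Only v can have the colour of a, and the arc from a to v is missing.
  replace-deletion {inj₂ .a} {inj₁ v} refl =
    let cH , okH = H.deletion (S⊆ b∈S)
        cD , okD , only = D.alone v (cH a)
        c = [ cD , cH ]′
    in c , noClosedWalk-⊎ (Mono (N ∖ (inj₂ a , inj₁ v)) c) a (λ _ → ⊥)
      (λ ((d , _) , q) → d , q)
      (λ (((h , ≢S) , _) , q) → (h , λ { (refl , refl) → ≢S (refl , b∈S) }) , q)
      (λ { ((refl , ≢e) , q) → contradiction (refl , cong inj₁ (only _ (sym q))) ≢e })
      (λ ())
      (λ ())
      okD okH
  -- Any dicolouring of D works here: the arcs from a to S are all present in the
  -- coloured part of H.
  replace-deletion {inj₂ y} {inj₂ y′} (h , ≢S) =
    let cH , okH = H.deletion h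
        cD , okD , _ = D.alone D.point (cH a)
        c = [ cD , cH ]′
    in c , noClosedWalk-⊎ (Mono (N ∖ (inj₂ y , inj₂ y′)) c) a (λ x → cD x ≡ cH a)
      (λ ((d , _) , q) → d , q)
      (λ (((h , _) , ≢e) , q) → (h , λ { (refl , refl) → ≢e (refl , refl) }) , q)
      (λ { ((refl , _) , q) → refl , sym q })
      (λ p (_ , q) → trans (sym q) p)
      (λ p ((s , _) , q) → (S⊆ s , λ { (refl , refl) → ≢S (refl , s) }) , trans (sym p) q)
      okD okH

  replace-covered : ∀ p → (∃[ q ] N p q) ⊎ (∃[ q ] N q p)
  replace-covered (inj₁ x) = inj₁ (inj₂ b , b∈S)
  replace-covered (inj₂ y) with H.covered y
  ... | inj₁ (y′ , h) with y ≟ a | S? y′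
  ...   | yes refl | _     = inj₁ (inj₁ D.point , refl)
  ...   | no y≢a   | _     = inj₁ (inj₂ y′ , h , y≢a ∘ proj₁)
  replace-covered (inj₂ y) | inj₂ (y′ , h) with S? y
  ...   | yes s = inj₂ (inj₁ D.point , s)
  ...   | no ¬s = inj₂ (inj₂ y′ , h , ¬s ∘ proj₂)

  replace-arcCritical : ArcCritical (suc k) N
  replace-arcCritical = record
    { uncolourable = replace-uncolourable
    ; deletion     = replace-deletion
    ; covered      = replace-covered
    }

-- Invariance of criticality under a bijection of the vertices.
module _ {Z : Set} (f : Z → X) (g : X → Z) (fg : ∀ x → f (g x) ≡ x) (gf : ∀ z → g (f z) ≡ z)
  {R : Rel X 0ℓ} where

  private
    R∘f : Rel Z 0ℓ
    R∘f u v = R (f u) (f v)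

    injective : ∀ {u v} → f u ≡ f v → u ≡ v
    injective {u} {v} eq = trans (sym (gf u)) (trans (cong g eq) (gf v))

  arcCritical-∘ : ArcCritical k R → ArcCritical k R∘f
  arcCritical-∘ {k} crit = record
    { uncolourable = λ (c , ok) → uncolourable
        (c ∘ g , λ x w → ok (g x) (map-walk g
          (λ {x} {y} (r , q) → subst₂ R (sym (fg x)) (sym (fg y)) r , q) w))
    ; deletion = λ r → let c , ok = deletion r in
        c ∘ f , λ z w → ok (f z) (map-walk f
          (λ ((r , ≢e) , q) → (r , λ (s , t) → ≢e (injective s , injective t)) , q) w)
    ; covered = λ z → covered′ z (covered (f z))
    }
    where
    open ArcCritical crit
    covered′ : ∀ z → (∃[ y ] R (f z) y) ⊎ (∃[ y ] R y (f z)) →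
      (∃[ u ] R∘f z u) ⊎ (∃[ u ] R∘f u z)
    covered′ z (inj₁ (y , r)) = inj₁ (g y , subst (R (f z)) (sym (fg y)) r)
    covered′ z (inj₂ (y , r)) = inj₂ (g y , subst (λ y → R y (f z)) (sym (fg y)) r)

-- Decidable digraphs on Fin n

-- Loops and digons are allowed.
record Graph (n : ℕ) : Set₁ where
  field
    E  : Rel (Fin n) 0ℓ
    E? : Decidable E

open Graph

IsOriented : Graph n → Set
IsOriented G = ∀ {u v} → E G u v → ¬ E G v u

replace? : {D : Rel X 0ℓ} {H : Rel Y 0ℓ} {a : Y} {S : Y → Set} →
  Decidable D → Decidable H → (∀ y → Dec (y ≡ a)) → (∀ y → Dec (S y)) →
  Decidable (Replace D H a S)
replace? D? H? ≟a S? (inj₁ x) (inj₁ x′) = D? x x′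
replace? D? H? ≟a S? (inj₁ x) (inj₂ y)  = S? y
replace? D? H? ≟a S? (inj₂ y) (inj₁ x)  = ≟a y
replace? D? H? ≟a S? (inj₂ y) (inj₂ y′) = H? y y′ ×-dec ¬? (≟a y ×-dec S? y′)

-- The first m vertices are those of D.
replace : ∀ {m n} → Graph m → (H : Graph n) (a : Fin n) {S : Fin n → Set} →
  (∀ y → Dec (S y)) → Graph (m + n)
replace {m} D H a {S} S? = record
  { E  = λ u v → Replace (E D) (E H) a S (splitAt m u) (splitAt m v)
  ; E? = λ u v → replace? (E? D) (E? H) (Fin._≟ a) S? (splitAt m u) (splitAt m v)
  }

replace-critical : ∀ {m n} (D : Graph m) (H : Graph n) → Critical k (E D) →
  ArcCritical (suc k) (E H) → (a : Fin n) {S : Fin n → Set} (S? : ∀ y → Dec (S y)) →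
  (∀ {y} → S y → E H a y) → (b : Fin n) → S b → ArcCritical (suc k) (E (replace D H a S?))
replace-critical {m = m} {n} D H critD critH a S? S⊆ b b∈S =
  arcCritical-∘ (splitAt m) (join m n) (splitAt-join m n) (join-splitAt m n)
    (replace-arcCritical Fin._≟_ critD critH a S? S⊆ b b∈S)

-- H itself may contain digons, provided that one arc of each is replaced.
replace-oriented : ∀ {m n} (D : Graph m) (H : Graph n) (a : Fin n) {S : Fin n → Set}
  (S? : ∀ y → Dec (S y)) → IsOriented D → ¬ S a →
  (∀ {y y′} → E H y y′ → ¬ (y ≡ a × S y′) → E H y′ y → ¬ (y′ ≡ a × S y) → ⊥) →
  IsOriented (replace D H a S?)
replace-oriented {m} D H a {S} S? oD a∉S oH {u} {v} = go (splitAt m u) (splitAt m v)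
  where
  go : ∀ p q → Replace (E D) (E H) a S p q → ¬ Replace (E D) (E H) a S q p
  go (inj₁ _) (inj₁ _) d d′ = oD d d′
  go (inj₁ _) (inj₂ _) s refl = a∉S s
  go (inj₂ _) (inj₁ _) refl s = a∉S s
  go (inj₂ _) (inj₂ _) (h , e) (h′ , e′) = oH h e h′ e′

loop : Graph 1
loop = record { E = λ _ _ → ⊤ ; E? = λ _ _ → yes tt }

loop-critical : ArcCritical (suc k) (E loop)
loop-critical = record
  { uncolourable = λ (c , ok) → ok zero [ tt , refl ]
  ; deletion     = λ { {zero} {zero} _ → (λ _ → zero) , λ { zero w → no-arc w } }
  ; covered      = λ _ → inj₁ (zero , tt)
  }
  where
  no-arc : ∀ {x y} {c : Fin 1 → Fin (suc k)} →
    ¬ TransClosure (Mono (E loop ∖ (zero , zero)) c) x y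
  no-arc {x = zero} (_∷_ {y = zero} ((_ , ≢e) , _) _) = ≢e (refl , refl)
  no-arc {x = zero} {zero} [ (_ , ≢e) , _ ] = ≢e (refl , refl)

-- D and a new vertex joined to each vertex of D by a digon.
cone : Graph n → Graph (n + 1)
cone D = replace D loop zero {E loop zero} (E? loop zero)

apex : ∀ n → Fin (n + 1)
apex n = n ↑ʳ zero

-- A (k+1)-dicritical oriented graph on Fin n.
record CriticalOriented (k n : ℕ) : Set₁ where
  field
    graph    : Graph n
    oriented : IsOriented graph
    critical : Critical k (E graph)

open CriticalOriented

-- The same without isolated vertices, which excludes only the single vertex.
record ArcCriticalOriented (k n : ℕ) : Set₁ where
  field
    graph       : Graph n
    oriented    : IsOriented graph
    arcCritical : ArcCritical k (E graph)

open ArcCriticalOriented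

-- Two copies of D and a vertex x, with all arcs from x to the first copy, from
-- the first copy to the second and from the second copy to x.
tripleJoinGraph : Graph n → Graph (n + (n + 1))
tripleJoinGraph {n} D = replace D (cone D) (apex n) {E (cone D) (apex n)} (E? (cone D) (apex n))

tripleJoin : CriticalOriented k n → ArcCriticalOriented (suc k) (n + (n + 1))
tripleJoin {k} {n} D = record
  { graph       = tripleJoinGraph (graph D)
  ; oriented    = replace-oriented (graph D) (cone (graph D)) (apex n) (E? C (apex n))
      (oriented D) apex-irrefl (λ {y} {y′} e ≢S e′ ≢S′ → cone-oriented y y′ e ≢S e′ ≢S′)
  ; arcCritical = replace-critical (graph D) C (critical D)
      (replace-critical (graph D) loop (critical D) loop-critical
        zero {E loop zero} (E? loop zero) id zero tt)
      (apex n) {E C (apex n)} (E? C (apex n)) id (point ↑ˡ 1) apex-point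
  }
  where
  C = cone (graph D)
  open Critical (critical D)

  apex-irrefl : ¬ E C (apex n) (apex n)
  apex-irrefl e rewrite splitAt-join n 1 (inj₂ zero) = proj₂ e (refl , tt)

  apex-out : ∀ x → Replace (E (graph D)) (E loop) zero (E loop zero) (splitAt n (apex n)) (inj₁ x)
  apex-out x rewrite splitAt-join n 1 (inj₂ zero) = refl

  apex-point : E C (apex n) (point ↑ˡ 1)
  apex-point rewrite splitAt-join n 1 (inj₁ point) = apex-out point

  is-apex : ∀ y → splitAt n y ≡ inj₂ zero → y ≡ apex n
  is-apex y eq = trans (sym (join-splitAt n 1 y)) (cong (join n 1) eq)

  -- Each digon of the cone contains an arc leaving the apex.
  cone-oriented : ∀ y y′ → E C y y′ → ¬ (y ≡ apex n × E C (apex n) y′) →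
    E C y′ y → ¬ (y′ ≡ apex n × E C (apex n) y) → ⊥
  cone-oriented y y′ e ≢S e′ ≢S′ with splitAt n y in eq | splitAt n y′ in eq′
  ... | inj₁ _    | inj₁ _    = oriented D e e′
  ... | inj₂ zero | inj₂ zero = proj₂ e (refl , tt)
  ... | inj₂ zero | inj₁ x    = ≢S (is-apex y eq , apex-out x)
  ... | inj₁ x    | inj₂ zero = ≢S′ (is-apex y′ eq′ , apex-out x)

singleVertex : CriticalOriented 0 1
singleVertex = record
  { graph    = record { E = λ _ _ → ⊥ ; E? = λ _ _ → no id }
  ; oriented = λ ()
  ; critical = record
    { uncolourable = λ (c , _) → Fin.¬Fin0 (c zero)
    ; deletion     = λ ()
    ; alone        = λ v γ → (λ _ → γ) , (λ { x [ () , _ ] ; x ((() , _) ∷ _) }) ,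
                             λ { zero _ → unique v }
    ; point        = zero
    }
  }
  where
  unique : ∀ v → zero ≡ v
  unique zero = refl

module _ (G : ArcCriticalOriented (suc k) n) where

  open ArcCritical (arcCritical G)

  arc-exists : ∃[ a ] ∃[ b ] E (graph G) a b
  arc-exists with any? (λ a → any? (λ b → E? (graph G) a b))
  ... | yes e = e
  ... | no ¬e = contradiction ((λ _ → zero) , no-walk) uncolourable
    where
    no-walk : NoClosedWalk (Mono (E (graph G)) (λ _ → zero {k}))
    no-walk x [ e , _ ]     = ¬e (x , _ , e)
    no-walk x ((e , _) ∷ _) = ¬e (x , _ , e)

  asCritical : CriticalOriented (suc k) n
  asCritical = record
    { graph    = graph G
    ; oriented = oriented G
    ; critical = arcCritical⇒critical Fin._≟_ (λ e → oriented G e e) (proj₁ arc-exists) (arcCritical G)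
    }

replaceArc : ∀ {m n} → CriticalOriented k m → (H : ArcCriticalOriented (suc k) n) (a b : Fin n) →
  E (graph H) a b → ArcCriticalOriented (suc k) (m + n)
replaceArc D H a b ab = record
  { graph       = replace (graph D) (graph H) a (Fin._≟ b)
  ; oriented    = replace-oriented (graph D) (graph H) a (Fin._≟ b) (oriented D)
      (λ { refl → oriented H ab ab }) (λ e _ e′ _ → oriented H e e′)
  ; arcCritical = replace-critical (graph D) (graph H) (critical D) (arcCritical H)
      a (Fin._≟ b) (λ { refl → ab }) b refl
  }

-- The number of arcs

-- The indicator of a decidable proposition.
ι : {P : Set} → Dec P → ℕ
ι P? = if does P? then 1 else 0

arcs : Graph n → ℕ
arcs {n} G = ∑[ u < n ] ∑[ v < n ] ι (E? G u v)

sum-splitAt : ∀ m {n} (f : Fin m ⊎ Fin n → ℕ) →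
  sum (f ∘ splitAt m) ≡ sum (f ∘ inj₁) + sum (f ∘ inj₂)
sum-splitAt zero    f = refl
sum-splitAt (suc m) f = trans
  (cong (f (inj₁ zero) +_) (sum-splitAt m (f ∘ Sum.map₁ suc)))
  (sym (ℕ.+-assoc (f (inj₁ zero)) _ _))

sum-const : ∀ n c → ∑[ i < n ] c ≡ n * c
sum-const zero    c = refl
sum-const (suc n) c = cong (c +_) (sum-const n c)

sum-indicator : (a : Fin n) → ∑[ i < n ] ι (i Fin.≟ a) ≡ 1
sum-indicator {suc n} zero    = cong suc (sum-replicate-zero n)
sum-indicator {suc n} (suc a) = sum-indicator a

ι-difference : {P Q : Set} (P? : Dec P) (Q? : Dec Q) → (Q → P) →
  ι (P? ×-dec ¬? Q?) + ι Q? ≡ ι P?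
ι-difference (yes p) (yes q) f = refl
ι-difference (yes p) (no ¬q) f = refl
ι-difference (no ¬p) (yes q) f = contradiction (f q) ¬p
ι-difference (no ¬p) (no ¬q) f = refl

sum-indicator₂ : (a b : Fin n) → ∑[ i < n ] ∑[ j < n ] ι ((i Fin.≟ a) ×-dec (j Fin.≟ b)) ≡ 1
sum-indicator₂ {n} a b = trans (sum-cong-≗ row) (sum-indicator a)
  where
  row : ∀ i → ∑[ j < n ] ι ((i Fin.≟ a) ×-dec (j Fin.≟ b)) ≡ ι (i Fin.≟ a)
  row i with i Fin.≟ a
  ... | yes _ = sum-indicator b
  ... | no  _ = sum-replicate-zero n

arcs-remove : (G : Graph n) (a b : Fin n) → E G a b →
  ∑[ u < n ] ∑[ v < n ] ι (E? G u v ×-dec ¬? ((u Fin.≟ a) ×-dec (v Fin.≟ b))) + 1 ≡ arcs G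
arcs-remove {n} G a b ab = begin
  ∑[ u < n ] ∑[ v < n ] kept u v + 1
    ≡⟨ cong (∑[ u < n ] ∑[ v < n ] kept u v +_) (sum-indicator₂ a b) ⟨
  ∑[ u < n ] ∑[ v < n ] kept u v + ∑[ u < n ] ∑[ v < n ] gone u v
    ≡⟨ ∑-distrib-+ (λ u → ∑[ v < n ] kept u v) (λ u → ∑[ v < n ] gone u v) ⟨
  ∑[ u < n ] (∑[ v < n ] kept u v + ∑[ v < n ] gone u v)
    ≡⟨ sum-cong-≗ (λ u → trans (sym (∑-distrib-+ (kept u) (gone u)))
         (sum-cong-≗ (λ v → ι-difference (E? G u v) ((u Fin.≟ a) ×-dec (v Fin.≟ b))
           (λ { (refl , refl) → ab })))) ⟩
  arcs G ∎
  where
  open ≡-Reasoning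
  kept gone : Fin n → Fin n → ℕ
  kept u v = ι (E? G u v ×-dec ¬? ((u Fin.≟ a) ×-dec (v Fin.≟ b)))
  gone u v = ι ((u Fin.≟ a) ×-dec (v Fin.≟ b))

arcs-replace : ∀ {m n} (D : Graph m) (H : Graph n) (a b : Fin n) → E H a b →
  arcs (replace D H a (Fin._≟ b)) + 1 ≡ arcs D + 2 * m + arcs H
arcs-replace {m} {n} D H a b ab = begin
  arcs (replace D H a (Fin._≟ b)) + 1
    ≡⟨ cong (_+ 1) (trans (sum-splitAt m (λ p → sum (λ v → entry p (splitAt m v))))
         (cong₂ _+_ (sum-cong-≗ (λ x → sum-splitAt m (entry (inj₁ x))))
                    (sum-cong-≗ (λ y → sum-splitAt m (entry (inj₂ y)))))) ⟩
  (∑[ x < m ] (∑[ x′ < m ] ι (E? D x x′) + ∑[ y < n ] ι (y Fin.≟ b)) +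
   ∑[ y < n ] (∑[ x < m ] ι (y Fin.≟ a) + rest y)) + 1
    ≡⟨ cong (_+ 1) (cong₂ _+_ (∑-distrib-+ (λ x → ∑[ x′ < m ] ι (E? D x x′)) _)
                              (∑-distrib-+ (λ y → ∑[ x < m ] ι (y Fin.≟ a)) rest)) ⟩
  ((arcs D + ∑[ x < m ] ∑[ y < n ] ι (y Fin.≟ b)) +
   (∑[ y < n ] ∑[ x < m ] ι (y Fin.≟ a) + sum rest)) + 1
    ≡⟨ cong (_+ 1) (cong₂ _+_ (cong (arcs D +_) (m-times b))
         (cong (_+ sum rest) (trans (∑-comm {n} {m} (λ y _ → ι (y Fin.≟ a))) (m-times a)))) ⟩
  ((arcs D + m * 1) + (m * 1 + sum rest)) + 1
    ≡⟨ arith (arcs D) m (sum rest) ⟩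
  arcs D + 2 * m + (sum rest + 1)
    ≡⟨ cong (arcs D + 2 * m +_) (arcs-remove H a b ab) ⟩
  arcs D + 2 * m + arcs H ∎
  where
  open ≡-Reasoning
  entry : Fin m ⊎ Fin n → Fin m ⊎ Fin n → ℕ
  entry p q = ι (replace? {D = E D} {E H} {a} {_≡ b} (E? D) (E? H) (Fin._≟ a) (Fin._≟ b) p q)

  rest : Fin n → ℕ
  rest y = ∑[ y′ < n ] ι (E? H y y′ ×-dec ¬? ((y Fin.≟ a) ×-dec (y′ Fin.≟ b)))

  m-times : ∀ c → ∑[ x < m ] ∑[ y < n ] ι (y Fin.≟ c) ≡ m * 1
  m-times c = trans (sum-cong-≗ {m} (λ _ → sum-indicator c)) (sum-const m 1)

  arith : ∀ d m r → ((d + m * 1) + (m * 1 + r)) + 1 ≡ d + 2 * m + (r + 1)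
  arith = solve-∀

-- Sparse families

arith-step : ∀ j m n d h s e → s + 1 ≡ d + 2 * m + h → d ≤ (2 * j + 1) * m →
  h ≤ (2 * suc j + 1) * n + e → s + 1 ≤ (2 * suc j + 1) * (m + n) + e
arith-step j m n d h s e eq d≤ h≤ = begin
  s + 1                                                     ≡⟨ eq ⟩
  d + 2 * m + h                                             ≤⟨ ℕ.+-mono-≤ (ℕ.+-monoˡ-≤ (2 * m) d≤) h≤ ⟩
  (2 * j + 1) * m + 2 * m + ((2 * suc j + 1) * n + e)       ≡⟨ regroup j m n e ⟩
  (2 * suc j + 1) * (m + n) + e                             ∎
  where
  open ℕ.≤-Reasoning
  regroup : ∀ j m n e → (2 * j + 1) * m + 2 * m + ((2 * suc j + 1) * n + e) ≡
    (2 * suc j + 1) * (m + n) + e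
  regroup = solve-∀

-- All large orders are realised by (j+2)-dicritical oriented graphs within the
-- bound; for k = j + 2 the slope 2k - 3 is 2j + 1.
Family : ℕ → Set₁
Family j = ∃[ N ] (∀ n → n ≥ N → Σ (ArcCriticalOriented (suc j) n) λ G →
  arcs (graph G) ≤ (2 * j + 1) * n × (j > 0 → arcs (graph G) < (2 * j + 1) * n))

-- The directed cycles, obtained from the triangle by subdivision.
cycle : ∀ m → Σ (ArcCriticalOriented 1 (3 + m)) λ G → arcs (graph G) ≡ 3 + m
cycle zero    = tripleJoin singleVertex , refl
cycle (suc m) =
  let C , eq = cycle m
      a , b , ab = arc-exists C
      C′ = replaceArc singleVertex C a b ab
  in C′ , ℕ.+-cancelʳ-≡ 1 _ _ (trans (arcs-replace (graph singleVertex) (graph C) a b ab)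
            (trans (cong (2 +_) eq) (ℕ.+-comm 1 (4 + m))))

cycles : Family 0
cycles = 3 , λ n n≥3 → subst
  (λ n → Σ (ArcCriticalOriented 1 n) λ G → arcs (graph G) ≤ 1 * n × (0 > 0 → arcs (graph G) < 1 * n))
  (ℕ.m+[n∸m]≡n n≥3)
  (let C , eq = cycle (n ∸ 3) in C , ℕ.≤-reflexive (trans eq (sym (ℕ.*-identityˡ _))) , λ ())

family-step : ∀ {j} → Family j → Family (suc j)
family-step {j} (N , member) =
  let h , H , H≤ = reduce (arcs (graph initial)) initial (ℕ.m≤n+m _ _)
  in N + h , λ n n≥ → subst Good (ℕ.m∸n+n≡m (ℕ.m+n≤o⇒n≤o N n≥))
       (combine H H≤ (n ∸ h) (ℕ.m+n≤o⇒m≤o∸n N n≥))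
  where
  Good : ℕ → Set₁
  Good n = Σ (ArcCriticalOriented (2 + j) n) λ G →
    arcs (graph G) ≤ (2 * suc j + 1) * n × (suc j > 0 → arcs (graph G) < (2 * suc j + 1) * n)

  initial : ArcCriticalOriented (2 + j) (N + (N + 1))
  initial = tripleJoin (asCritical (proj₁ (member N ℕ.≤-refl)))

  attach : ∀ {h e} (H : ArcCriticalOriented (2 + j) h) → arcs (graph H) ≤ (2 * suc j + 1) * h + e →
    ∀ m → m ≥ N → Σ (ArcCriticalOriented (2 + j) (m + h)) λ G →
      arcs (graph G) + 1 ≤ (2 * suc j + 1) * (m + h) + e
  attach {h} {e} H H≤ m m≥N =
    let D , D≤ , _ = member m m≥N
        a , b , ab = arc-exists H
        D′ = asCritical D
    in replaceArc D′ H a b ab ,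
       arith-step j m h _ _ _ e (arcs-replace (graph D′) (graph H) a b ab) D≤ H≤

  -- Each replacement lowers the excess e by one.
  reduce : ∀ e {h} (H : ArcCriticalOriented (2 + j) h) → arcs (graph H) ≤ (2 * suc j + 1) * h + e →
    ∃[ h ] Σ (ArcCriticalOriented (2 + j) h) λ H → arcs (graph H) ≤ (2 * suc j + 1) * h + 0
  reduce zero    H H≤ = _ , H , H≤
  reduce (suc e) H H≤ =
    let G , G≤ = attach H H≤ N ℕ.≤-refl
    in reduce e G (s≤s⁻¹ (subst₂ _≤_ (ℕ.+-comm _ 1) (ℕ.+-suc _ e) G≤))

  combine : ∀ {h} (H : ArcCriticalOriented (2 + j) h) → arcs (graph H) ≤ (2 * suc j + 1) * h + 0 →
    ∀ m → m ≥ N → Good (m + h)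
  combine H H≤ m m≥N =
    let G , G≤ = attach H H≤ m m≥N
        G< = subst₂ _≤_ (ℕ.+-comm _ 1) (ℕ.+-identityʳ _) G≤
    in G , ℕ.<⇒≤ G< , λ _ → G<

families : ∀ j → Family j
families zero    = cycles
families (suc j) = family-step (families j)

-- Closed walks and cycles

linked⇒walk : {R : Rel X 0ℓ} {x y : X} (vs : List X) → Linked R ((x ∷ vs) ∷ʳ y) → TransClosure R x y
linked⇒walk []       (r ∷ [-]) = [ r ]
linked⇒walk (v ∷ vs) (r ∷ l)   = r ∷ linked⇒walk vs l

module _ (_≟_ : DecidableEquality X) {R : Rel X 0ℓ} where

  open import Data.List.Membership.DecPropositional _≟_ using () renaming (_∈_ to _∈ˡ_; _∈?_ to _∈ˡ?_)

  -- The vertices of the walk other than its last one are distinct; the last one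
  -- is unconstrained, so a simple path from x to x is a cycle.
  SimplePath : X → X → Set
  SimplePath x y = ∃[ vs ] (Unique (x ∷ vs) × Linked R ((x ∷ vs) ∷ʳ y))

  suffix : ∀ {x y} {vs : List X} → x ∈ˡ vs → Unique vs → Linked R (vs ∷ʳ y) → SimplePath x y
  suffix (here refl) u       l = _ , u , l
  suffix (there i)   (_ ∷ u) l = suffix i u (Linked.tail l)

  walk⇒path : ∀ {x y} → TransClosure R x y → SimplePath x y
  walk⇒path [ r ] = [] , [] ∷ [] , r ∷ [-]
  walk⇒path {x} (_∷_ {y = z} r w) with walk⇒path w
  ... | vs , u , l with x ∈ˡ? (z ∷ vs)
  ...   | yes i = suffix i u l
  ...   | no x∉ = z ∷ vs , ¬Any⇒All¬ _ x∉ ∷ u , r ∷ l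

noClosedWalk⇒acyclic : (D : Digraph n) → NoClosedWalk (Arc D) → Acyclic D
noClosedWalk⇒acyclic D ok v vs (_ , l) = ok v (linked⇒walk vs l)

acyclic⇒noClosedWalk : (D : Digraph n) → Acyclic D → NoClosedWalk (Arc D)
acyclic⇒noClosedWalk D ok v w = let vs , cycle = walk⇒path Fin._≟_ w in ok v vs cycle

lookup-injective : {vs : List X} → Unique vs → ∀ {i j} → List.lookup vs i ≡ List.lookup vs j → i ≡ j
lookup-injective (_ ∷ _) {zero}  {zero}  _  = refl
lookup-injective (v≢ ∷ _) {zero}  {suc j} eq = contradiction eq (All.lookup v≢ (∈-lookup j))
lookup-injective (v≢ ∷ _) {suc i} {zero}  eq = contradiction (sym eq) (All.lookup v≢ (∈-lookup i))
lookup-injective (_ ∷ u) {suc i} {suc j} eq = cong suc (lookup-injective u eq)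

unique⇒length≤ : {vs : List (Fin n)} → Unique vs → length vs ≤ n
unique⇒length≤ u = Fin.injective⇒≤ (lookup-injective u)

-- Deciding dicolourability

anyList? : ∀ m {P : List (Fin n) → Set} → (∀ vs → Dec (P vs)) → Dec (∃[ vs ] (length vs ≤ m × P vs))
anyList? zero P? = map′ (λ p → [] , z≤n , p) (λ { ([] , _ , p) → p }) (P? [])
anyList? (suc m) P? =
  map′ [ (λ p → [] , z≤n , p) , (λ (v , vs , l , p) → v ∷ vs , s≤s l , p) ]′
    (λ { ([] , _ , p) → inj₁ p ; (v ∷ vs , s≤s l , p) → inj₂ (v , vs , l , p) })
    (P? [] ⊎-dec any? (λ v → anyList? m (P? ∘ (v ∷_))))

-- The vertices of a cycle are distinct, so it suffices to search bounded lists.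
acyclic? : (D : Digraph n) → Dec (Acyclic D)
acyclic? {n} D = map′
  (λ none v vs c → none v (vs , ℕ.≤-trans (ℕ.n≤1+n _) (unique⇒length≤ (proj₁ c)) , c))
  (λ ok v (vs , _ , c) → ok v vs c)
  (all? λ v → ¬? (anyList? n λ vs →
    unique? Fin._≟_ (v ∷ vs) ×-dec linked? (λ u w → w ∈? lookup (A D) u) ((v ∷ vs) ∷ʳ v)))

∈-tabulate⁺ : {f : Fin n → Bool} {v : Fin n} → f v ≡ true → v ∈ tabulate f
∈-tabulate⁺ {f = f} {v} eq = lookup⇒[]= v (tabulate f) (trans (lookup∘tabulate f v) eq)

∈-tabulate⁻ : {f : Fin n → Bool} {v : Fin n} → v ∈ tabulate f → f v ≡ true
∈-tabulate⁻ {f = f} {v} v∈ = trans (sym (lookup∘tabulate f v)) ([]=⇒lookup v∈)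

module _ (c : Fin n → ℕ) {i : ℕ} {v : Fin n} where

  ∈-colourClass⁺ : c v ≡ i → v ∈ colourClass c i
  ∈-colourClass⁺ eq = ∈-tabulate⁺ (trans (isYes≗does (c v ℕ.≟ i)) (dec-true (c v ℕ.≟ i) eq))

  ∈-colourClass⁻ : v ∈ colourClass c i → c v ≡ i
  ∈-colourClass⁻ v∈ with c v ℕ.≟ i | ∈-tabulate⁻ {f = λ v → ⌊ c v ℕ.≟ i ⌋} v∈
  ... | yes eq | _ = eq

module _ (D : Digraph n) {X : Subset n} where

  induced-row⁺ : ∀ {u v} → Arc D u v → u ∈ X → v ∈ X → v ∈ inducedRow D X u
  induced-row⁺ {u} uv u∈X v∈X with u ∈? X
  ... | yes _  = x∈p∩q⁺ (uv , v∈X)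
  ... | no u∉X = contradiction u∈X u∉X

  induced-arc⁺ : ∀ {u v} → Arc D u v → u ∈ X → v ∈ X → Arc (induced D X) u v
  induced-arc⁺ {u} {v} uv u∈X v∈X =
    subst (v ∈_) (sym (lookup∘tabulate (inducedRow D X) u)) (induced-row⁺ uv u∈X v∈X)

module _ (D : Digraph n) (c : Fin n → ℕ) where

  classes-acyclic : NoClosedWalk (Mono (Arc D) c) → ∀ i → Acyclic (induced D (colourClass c i))
  classes-acyclic ok i = noClosedWalk⇒acyclic (induced D (colourClass c i)) λ v w →
    ok v (map-walk id (λ e → let uv , u∈ , v∈ = induced-arc⁻ D (colourClass c i) e in
      uv , trans (∈-colourClass⁻ c u∈) (sym (∈-colourClass⁻ c v∈))) w)

  dicolouring⇒noClosedWalk : IsDicolouring D k c → NoClosedWalk (Mono (Arc D) c)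
  dicolouring⇒noClosedWalk (bound , classes) v w =
    acyclic⇒noClosedWalk (induced D (colourClass c (c v)))
      (classes (c v) (bound v (tail∈V w))) v (in-class refl w)
    where
    tail∈V : ∀ {u v} → TransClosure (Mono (Arc D) c) u v → u ∈ V D
    tail∈V [ uv , _ ]     = source D uv
    tail∈V ((uv , _) ∷ _) = source D uv

    in-class : ∀ {i u v} → c u ≡ i → TransClosure (Mono (Arc D) c) u v →
      TransClosure (Arc (induced D (colourClass c i))) u v
    in-class eq [ uv , q ] =
      [ induced-arc⁺ D uv (∈-colourClass⁺ c eq) (∈-colourClass⁺ c (trans (sym q) eq)) ]
    in-class eq ((uv , q) ∷ w) =
      induced-arc⁺ D uv (∈-colourClass⁺ c eq) (∈-colourClass⁺ c (trans (sym q) eq)) ∷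
      in-class (trans (sym q) eq) w

-- A colouring d is a dicolouring when it refines a dicolouring c on the colours
-- below k and uses only such colours where c does.
dicolouring-cong : (D : Digraph n) {c d : Fin n → ℕ} → (∀ v → c v < k → d v < k) →
  (∀ {u v} → d u < k → d u ≡ d v → c u ≡ c v) → IsDicolouring D k c → IsDicolouring D k d
dicolouring-cong {k = k} D {c} {d} bound refines ok@(c<k , _) =
  d<k , λ i _ → classes-acyclic D d (λ v w → dicolouring⇒noClosedWalk D c ok v
    (map-walk id (λ (uv , q) → uv , refines (d<k _ (source D uv)) q) w)) i
  where
  d<k : ∀ v → v ∈ V D → d v < k
  d<k v v∈ = bound v (c<k v v∈)

isDicolouring? : (D : Digraph n) (k : ℕ) (c : Fin n → ℕ) → Dec (IsDicolouring D k c)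
isDicolouring? D k c =
  all? (λ v → (v ∈? V D) →-dec (c v ℕ.<? k)) ×-dec
  map′ (λ f i i<k → f i<k) (λ f {i} i<k → f i i<k)
    (ℕ.allUpTo? (λ i → acyclic? (induced D (colourClass c i))) k)

dicolourable? : (D : Digraph n) (k : ℕ) → Dec (Dicolourable D k)
dicolourable? {n} D k = map′ (λ (i , ok) → colouring i , ok) search
  (any? {suc k ^ n} λ i → isDicolouring? D k (colouring i))
  where
  colouring : Fin (suc k ^ n) → Fin n → ℕ
  colouring i = toℕ ∘ finToFun i

  search : Dicolourable D k → ∃[ i ] IsDicolouring D k (colouring i)
  search (c , ok) = i , dicolouring-cong D
    (λ v c<k → subst (_< k) (sym (trans (value v) (ℕ.m≤n⇒m⊓n≡m (ℕ.<⇒≤ c<k)))) c<k)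
    (λ {u} {v} d<k q → trans (small u d<k) (trans q (sym (small v (subst (_< k) q d<k))))) ok
    where
    -- The colours that are at least k occur outside V D only; they are all
    -- replaced by k, which leaves finitely many colourings to search.
    clip : Fin n → Fin (suc k)
    clip v = fromℕ< (s≤s (ℕ.m⊓n≤n (c v) k))

    i = funToFin clip

    value : ∀ v → colouring i v ≡ c v ⊓ k
    value v = trans (cong toℕ (Fin.finToFun-funToFin clip v)) (Fin.toℕ-fromℕ< _)

    small : ∀ v → colouring i v < k → c v ≡ colouring i v
    small v d<k with ℕ.⊓-sel (c v) k
    ... | inj₁ eq = sym (trans (value v) eq)
    ... | inj₂ eq = contradiction (subst (_< k) (trans (value v) eq) d<k) (ℕ.<-irrefl refl)

least : {P : ℕ → Set} → (∀ i → Dec (P i)) → ∀ m → P m →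
  ∃[ j ] ((P j × (∀ i → P i → j ≤ i)) × j ≤ m)
least P? m p with P? 0
... | yes p₀ = 0 , (p₀ , λ _ _ → z≤n) , z≤n
least P? zero p | no ¬p₀ = contradiction p ¬p₀
least {P} P? (suc m) p | no ¬p₀ =
  let j , (q , min) , j≤m = least (P? ∘ suc) m p
  in suc j , (q , λ { zero p₀ → contradiction p₀ ¬p₀ ; (suc i) r → s≤s (min i r) }) , s≤s j≤m

-- From decidable relations to digraphs

matrix : {R : Rel (Fin n) 0ℓ} → Decidable R → Vec (Subset n) n
matrix R? = tabulate λ u → tabulate λ v → does (R? u v)

module _ {R : Rel (Fin n) 0ℓ} (R? : Decidable R) {u v : Fin n} where

  private
    row : lookup (matrix R?) u ≡ tabulate (λ v → does (R? u v))
    row = lookup∘tabulate (λ u → tabulate λ v → does (R? u v)) u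

  ∈-matrix⁺ : R u v → v ∈ lookup (matrix R?) u
  ∈-matrix⁺ r = subst (v ∈_) (sym row) (∈-tabulate⁺ (dec-true (R? u v) r))

  ∈-matrix⁻ : v ∈ lookup (matrix R?) u → R u v
  ∈-matrix⁻ v∈ with R? u v | ∈-tabulate⁻ {f = λ v → does (R? u v)} (subst (v ∈_) row v∈)
  ... | yes r | _ = r

sum-tabulate : (f : Fin n → ℕ) → Vec.sum (tabulate f) ≡ sum f
sum-tabulate {zero}  f = refl
sum-tabulate {suc n} f = cong (f zero +_) (sum-tabulate (f ∘ suc))

∣tabulate∣ : (f : Fin n → Bool) → ∣ tabulate f ∣ ≡ ∑[ v < n ] (if f v then 1 else 0)
∣tabulate∣ {zero}  f = refl
∣tabulate∣ {suc n} f with f zero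
... | true  = cong suc (∣tabulate∣ (f ∘ suc))
... | false = ∣tabulate∣ (f ∘ suc)

module _ (G : CriticalOriented k n) where

  private
    module G = Critical (critical G)
    R  = E (graph G)
    R? = E? (graph G)

  digraph : Digraph n
  digraph .V = Subset.⊤
  digraph .A = matrix R?
  digraph .source _ = ∈⊤
  digraph .target _ = ∈⊤
  digraph .loopless v∈ = let r = ∈-matrix⁻ R? v∈ in oriented G r r

  size-digraph : size digraph ≡ arcs (graph G)
  size-digraph = trans (cong Vec.sum (sym (tabulate-∘ ∣_∣ λ u → tabulate λ v → does (R? u v))))
    (trans (sum-tabulate λ u → ∣ tabulate (λ v → does (R? u v)) ∣)
      (sum-cong-≗ (λ u → ∣tabulate∣ (λ v → does (R? u v)))))

  chromatic≥ : ∀ j → Dicolourable digraph j → suc k ≤ j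
  chromatic≥ j (c , ok@(c<j , _)) with suc k ℕ.≤? j
  ... | yes k<j = k<j
  ... | no  k≮j = contradiction
    ((λ v → fromℕ< (c<k v)) , λ v w → dicolouring⇒noClosedWalk digraph c ok v
      (map-walk id (λ (r , q) → ∈-matrix⁺ R? r , Fin.fromℕ<-injective _ _ (c<k _) (c<k _) q) w))
    G.uncolourable
    where
    c<k : ∀ v → c v < k
    c<k v = ℕ.<-≤-trans (c<j v ∈⊤) (s≤s⁻¹ (ℕ.≰⇒> k≮j))

  transfer : ∀ {m} (D′ : Digraph n) (c : Fin n → Fin m) {R′ : Rel (Fin n) 0ℓ} →
    (∀ {u v} → Arc D′ u v → R′ u v) → NoClosedWalk (Mono R′ c) →
    ∀ i → Acyclic (induced D′ (colourClass (toℕ ∘ c) i))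
  transfer D′ c sub ok = classes-acyclic D′ (toℕ ∘ c) λ v w →
    ok v (map-walk id (λ (uv , q) → sub uv , Fin.toℕ-injective q) w)

  dicolourable : Dicolourable digraph (suc k)
  dicolourable = let c , ok , _ = G.alone G.point zero in
    toℕ ∘ c , (λ v _ → Fin.toℕ<n (c v)) , λ i _ → transfer digraph c (∈-matrix⁻ R?) ok i

  subdigraph-dicolourable : (D′ : Digraph n) → ProperSubdigraph D′ digraph → Dicolourable D′ k
  subdigraph-dicolourable D′ ((V⊆ , A⊆) , proper) with all? (_∈? V D′)
  -- Some vertex v is missing: the last colour k, kept for v, is not used.
  ... | no ¬all =
    let v , v∉ = Fin.¬∀⟶∃¬ n _ (_∈? V D′) ¬all
        c , ok , only = G.alone v (fromℕ k)
    in toℕ ∘ c ,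
       (λ u u∈ → ℕ.≤∧≢⇒< (s≤s⁻¹ (Fin.toℕ<n (c u))) (λ eq → v∉ (subst (_∈ V D′)
         (only u (Fin.toℕ-injective (trans eq (sym (Fin.toℕ-fromℕ k))))) u∈))) ,
       λ i _ → transfer D′ c (∈-matrix⁻ R? ∘ A⊆) ok i
  ... | yes all with any? (λ u → any? (λ v → R? u v ×-dec ¬? (v ∈? lookup (A D′) u)))
  ...   | yes (u , v , r , uv∉) =
    let c , ok = G.deletion r
    in toℕ ∘ c , (λ v _ → Fin.toℕ<n (c v)) ,
       λ i _ → transfer D′ c (λ xy → ∈-matrix⁻ R? (A⊆ xy) , λ { (refl , refl) → uv∉ xy }) ok i
  ...   | no ¬missing = contradiction proper
    [ (λ V≢ → V≢ (⊆-antisym V⊆ (λ {v} _ → all v))) , (λ A≢ → A≢ A≡) ]′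
    where
    A≡ : A D′ ≡ A digraph
    A≡ = trans (sym (tabulate∘lookup (A D′))) (trans (tabulate-cong (λ u →
      ⊆-antisym A⊆ (λ {v} v∈ → decidable-stable (v ∈? lookup (A D′) u)
        (λ v∉ → ¬missing (u , v , ∈-matrix⁻ R? v∈ , v∉)))))
      (tabulate∘lookup (A digraph)))

  dicritical : Dicritical (suc k) digraph
  dicritical = (dicolourable , chromatic≥) , λ D′ proper →
    let j , χ , j≤k = least (dicolourable? D′) k (subdigraph-dicolourable D′ proper)
    in j , χ , s≤s j≤k

theorem4p4 : ∀ (k : ℕ) → k ≥ 2 →
    ∃[ N ] (∀ (n : ℕ) → n ≥ N →
    ∃[ a ] Σ (Digraph a) λ D →
    Oriented D × Dicritical k D × order D ≡ n ×
    size D ≤ (2 * k ∸ 3) * n ×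
    (k > 2 → size D < (2 * k ∸ 3) * n))
theorem4p4 (suc zero) (s≤s ())
theorem4p4 (suc (suc j)) _ = proj₁ (families j) , λ n n≥ →
  let G , G≤ , G< = proj₂ (families j) n n≥
      C = asCritical G
      size≡  = sym (size-digraph C)
      slope≡ = cong (_* n) (sym (slope j))
  in n , digraph C ,
     (λ uv vu → oriented C (∈-matrix⁻ (E? (graph C)) uv) (∈-matrix⁻ (E? (graph C)) vu)) ,
     dicritical C , ∣⊤∣≡n n , subst₂ _≤_ size≡ slope≡ G≤ ,
     λ k>2 → subst₂ _<_ size≡ slope≡ (G< (s≤s⁻¹ (s≤s⁻¹ k>2)))
  where
  slope : ∀ j → 2 * (2 + j) ∸ 3 ≡ 2 * j + 1
  slope j = cong (_∸ 3) (double j)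
    where
    double : ∀ j → 2 * (2 + j) ≡ 3 + (2 * j + 1)
    double = solve-∀
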